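{- Let $G$ be a nontrivial graph with $\gamma(G)=1$. The following statements hold. (i) If $\delta(G)\ge 2$, then for any graph $H$, $$\gamma_R^p(G\circ H)=|V(H)|-\Delta(H)+1.$$ (ii) If $\delta(G)=1$, then for any graph $H$, $$\gamma_R^p(G\circ H)=\min\{2\delta(H)+4,\ |V(H)|-\Delta(H)+1\}.$$
   Context: All graphs are finite, simple and undirected, with at least one vertex; a graph is nontrivial if it has at least two vertices. $\delta$ and $\Delta$ denote minimum and maximum degree. $\gamma(G)$ is the minimum size of a dominating set (a set $S$ such that every vertex outside $S$ has a neighbour in $S$). A perfect Roman dominating function (PRDF) on a graph $\Gamma$ is a function $f:V(\Gamma)\to\{0,1,2\}$ such that every vertex $u$ with $f(u)=0$ is adjacent to exactly one vertex $v$ with $f(v)=2$. Its weight is $\sum_v f(v)$, and $\gamma_R^p(\Gamma)$ is the minimum weight of a PRDF on $\Gamma$. The lexicographic product $G\circ H$ has vertex set $V(G)\times V(H)$, with $(u,v)$ adjacent to $(x,y)$ iff $ux\in E(G)$, or $u=x$ and $vy\in E(H)$. -}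

module Defs where

open import Data.Bool using (Bool; T)
open import Data.Bool.Properties using (T?)
open import Data.Fin using (Fin; toℕ)
open import Data.Fin.Patterns using (0F; 2F)
open import Data.List using (List; length; filter; map; sum; cartesianProduct)
open import Data.List.Extrema.Nat using (min; max)
open import Data.List.Membership.Propositional using (_∈_)
open import Data.List.Membership.Propositional.Properties using (∈-cartesianProduct⁺)
open import Data.List.Relation.Unary.Unique.Propositional using (Unique)
open import Data.List.Relation.Unary.Unique.Propositional.Properties using (cartesianProduct⁺)
open import Data.Nat using (ℕ; _≤_)
open import Data.Product using (Σ-syntax; ∃!; _×_; _,_; proj₁; proj₂)
open import Data.Product.Properties using (≡-dec)
open import Data.Sum using (_⊎_; inj₁; inj₂)
open import Relation.Binary using (Rel; Symmetric; DecidableEquality)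
import Relation.Binary as B
open import Relation.Binary.PropositionalEquality using (_≡_; refl; sym)
open import Relation.Nullary using (¬_)
open import Relation.Nullary.Decidable using (_×-dec_; _⊎-dec_)
open import Relation.Unary using (Pred; Decidable)
open import Level using (0ℓ)

-- Finiteness of V is given by a duplicate-free exhaustive list; adjacency is
-- decidable, as it always is classically.  The field `point` says that the
-- vertex set is nonempty.
record Graph : Set₁ where
  field
    V          : Set
    _≟_        : DecidableEquality V
    vertices   : List V
    unique     : Unique vertices
    complete   : ∀ v → v ∈ vertices
    point      : V
    Adj        : Rel V 0ℓ
    adj?       : B.Decidable Adj
    adj-sym    : Symmetric Adj
    adj-irrefl : ∀ {v} → ¬ Adj v v

  order : ℕ
  order = length vertices

  count : {P : Pred V 0ℓ} → Decidable P → ℕ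
  count P? = length (filter P? vertices)

  degree : V → ℕ
  degree v = count (adj? v)

  -- The first argument of `min` and `max` is only a base value for the empty
  -- list; `point` occurs in `vertices`, so it does not affect the minimum.
  -- Since Δ < order, the truncated subtraction order ∸ Δ is the exact difference.
  δ : ℕ
  δ = min (degree point) (map degree vertices)

  Δ : ℕ
  Δ = max 0 (map degree vertices)

  Nontrivial : Set
  Nontrivial = 2 ≤ order

  -- A set of vertices is represented by its characteristic function.
  size : (V → Bool) → ℕ
  size S = count (λ v → T? (S v))

  Dominating : (V → Bool) → Set
  Dominating S = ∀ u → ¬ T (S u) → Σ[ v ∈ V ] Adj u v × T (S v)

  PRDF : (V → Fin 3) → Set
  PRDF f = ∀ u → f u ≡ 0F → ∃! _≡_ (λ v → Adj u v × f v ≡ 2F)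

  weight : (V → Fin 3) → ℕ
  weight f = sum (map (λ v → toℕ (f v)) vertices)

open Graph public using (order; δ; Δ; Nontrivial)

-- k is the minimum of `value` over all x satisfying P: attained and a lower bound.
IsMinimum : {A : Set} → (A → Set) → (A → ℕ) → ℕ → Set
IsMinimum {A} P value k =
  (Σ[ x ∈ A ] P x × value x ≡ k) × (∀ x → P x → k ≤ value x)

-- γ(G) = k
IsDominationNumber : Graph → ℕ → Set
IsDominationNumber G = IsMinimum (Graph.Dominating G) (Graph.size G)

-- γ_R^p(G) = k
IsPerfectRomanDominationNumber : Graph → ℕ → Set
IsPerfectRomanDominationNumber G = IsMinimum (Graph.PRDF G) (Graph.weight G)

infixr 7 _∘ₗ_

_∘ₗ_ : Graph → Graph → Graph
G ∘ₗ H = record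
  { V          = G.V × H.V
  ; _≟_        = ≡-dec G._≟_ H._≟_
  ; vertices   = cartesianProduct G.vertices H.vertices
  ; unique     = cartesianProduct⁺ G.unique H.unique
  ; complete   = λ (u , v) → ∈-cartesianProduct⁺ (G.complete u) (H.complete v)
  ; point      = G.point , H.point
  ; Adj        = λ (u , v) (x , y) → G.Adj u x ⊎ (u ≡ x × H.Adj v y)
  ; adj?       = λ (u , v) (x , y) → G.adj? u x ⊎-dec (u G.≟ x ×-dec H.adj? v y)
  ; adj-sym    = λ { (inj₁ e) → inj₁ (G.adj-sym e)
                   ; (inj₂ (p , e)) → inj₂ (sym p , H.adj-sym e) }
  ; adj-irrefl = λ { (inj₁ e) → G.adj-irrefl e
                   ; (inj₂ (_ , e)) → H.adj-irrefl e }
  }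
  where
    module G = Graph G
    module H = Graph H

{-# OPTIONS --safe #-}
module Submission where

-- Let c be a vertex of G adjacent to all others, and let f be a PRDF on G ∘ H.
-- A fibre {u} × V(H) without zeros weighs at least |V(H)|, and some other fibre
-- (or a 2 in the same one) adds one more.  If instead every fibre has a zero,
-- then for each u there is at most one 2 in the fibres over neighbours of u; as c
-- is universal, this leaves at most two 2s, at most one of them over c.  A single
-- 2 at (x , y) leaves only neighbours of y to be 0 in the fibre of x, which
-- therefore weighs at least |V(H)| - Δ(H) + 1.  If there are two, at (c , a) and
-- (x , y), then c is the only neighbour of x, and the vertices (c , v) with v ~ a
-- and (x , v) with v ~ y would see both 2s, so they are nonzero and each of these
-- fibres weighs at least δ(H) + 2.  The first bound is attained by a star in the
-- fibre of c, the second by 2 at a vertex of minimum degree and 1 at its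
-- neighbours, in the fibres of a leaf of G and of its neighbour.

open import Defs
open import Algebra.Properties.CommutativeSemigroup using (interchange)
open import Data.Bool.Properties using (T?)
open import Data.Empty using (⊥-elim)
open import Data.Fin using (Fin; suc; toℕ)
import Data.Fin as Fin
open import Data.Fin.Patterns using (0F; 1F; 2F)
open import Data.List using (List; []; _∷_; length; filter; map; cartesianProduct)
open import Data.List.Extrema.Nat using (argmin-sel; argmax-sel; min≤xs; xs≤max; max≤v⁺)
open import Data.List.Membership.Propositional using (_∈_; lose)
open import Data.List.Membership.Propositional.Properties using (∈-map⁺; ∈-map⁻; ∈-filter⁺; ∈-filter⁻)
open import Data.List.Properties using (map-++; map-∘; length-filter)
open import Data.List.Relation.Unary.All using (All; []; _∷_)
import Data.List.Relation.Unary.All as All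
import Data.List.Relation.Unary.All.Properties as All
open import Data.List.Relation.Unary.AllPairs using ([]; _∷_)
open import Data.List.Relation.Unary.Any using (here; there; any?; satisfied)
open import Data.List.Relation.Unary.Unique.Propositional using (Unique)
open import Data.Nat using (ℕ; suc; _+_; _*_; _∸_; _≤_; _⊓_; z≤n; s≤s)
open import Data.Nat.ListAction using (sum)
open import Data.Nat.ListAction.Properties using (sum-++)
open import Data.Nat.Properties hiding (_≟_)
open import Data.Product using (∃; ∃!; Σ-syntax; _×_; _,_; proj₁; proj₂)
open import Data.Sum using (_⊎_; inj₁; inj₂)
open import Function using (_∘_)
open import Relation.Binary.PropositionalEquality
  using (_≡_; _≢_; refl; sym; trans; cong; cong₂; subst)
open import Relation.Nullary using (¬_; Dec; yes; no; ¬?)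
open import Relation.Nullary.Decidable using (map′; decidable-stable; _⊎-dec_)
open import Relation.Unary using (Pred; Decidable)
open import Level using (0ℓ)

-- Indicators and restricted labels

ind : {P : Set} → Dec P → ℕ
ind (yes _) = 1
ind (no _)  = 0

restrict : {P : Set} → Dec P → Fin 3 → Fin 3
restrict (yes _) k = k
restrict (no _)  _ = 0F

restrict-yes : {P : Set} (p? : Dec P) {k : Fin 3} → P → restrict p? k ≡ k
restrict-yes (yes _) _ = refl
restrict-yes (no ¬p) p = ⊥-elim (¬p p)

restrict-0 : {P : Set} (p? : Dec P) {k : Fin 3} → restrict p? k ≡ 0F → ¬ P ⊎ (P × k ≡ 0F)
restrict-0 (yes p) e = inj₂ (p , e)
restrict-0 (no ¬p) _ = inj₁ ¬p

restrict-2 : {P : Set} (p? : Dec P) {k : Fin 3} → restrict p? k ≡ 2F → P × k ≡ 2F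
restrict-2 (yes p) e = p , e

1≤toℕ : {k : Fin 3} → k ≢ 0F → 1 ≤ toℕ k
1≤toℕ {0F}    k≢0 = ⊥-elim (k≢0 refl)
1≤toℕ {suc _} _   = s≤s z≤n

sum-map-cartesianProduct : {A B : Set} (F : A × B → ℕ) (xs : List A) (ys : List B) →
  sum (map F (cartesianProduct xs ys)) ≡ sum (map (λ x → sum (map (λ y → F (x , y)) ys)) xs)
sum-map-cartesianProduct F []       ys = refl
sum-map-cartesianProduct F (x ∷ xs) ys =
  trans (cong sum (map-++ F (map (x ,_) ys) (cartesianProduct xs ys)))
  (trans (sum-++ (map F (map (x ,_) ys)) (map F (cartesianProduct xs ys)))
  (cong₂ _+_ (cong sum (sym (map-∘ ys))) (sum-map-cartesianProduct F xs ys)))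

module GraphProperties (Γ : Graph) where
  open Graph Γ public hiding (order; δ; Δ; Nontrivial)

  -- Sums over the vertex set

  ∑ : (V → ℕ) → ℕ
  ∑ F = sum (map F vertices)

  ∑-mono : {F K : V → ℕ} → (∀ v → F v ≤ K v) → ∑ F ≤ ∑ K
  ∑-mono {F} {K} F≤K = go vertices
    where
    go : ∀ xs → sum (map F xs) ≤ sum (map K xs)
    go []       = z≤n
    go (x ∷ xs) = +-mono-≤ (F≤K x) (go xs)

  ∑-cong : {F K : V → ℕ} → (∀ v → F v ≡ K v) → ∑ F ≡ ∑ K
  ∑-cong F≡K = ≤-antisym (∑-mono (≤-reflexive ∘ F≡K)) (∑-mono (≤-reflexive ∘ sym ∘ F≡K))

  ∑-+ : (F K : V → ℕ) → ∑ (λ v → F v + K v) ≡ ∑ F + ∑ K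
  ∑-+ F K = go vertices
    where
    go : ∀ xs → sum (map (λ v → F v + K v) xs) ≡ sum (map F xs) + sum (map K xs)
    go []       = refl
    go (x ∷ xs) = trans (cong (F x + K x +_) (go xs))
                        (interchange +-commutativeSemigroup (F x) (K x) _ _)

  ∑-*ʳ : (F : V → ℕ) (k : ℕ) → ∑ (λ v → F v * k) ≡ ∑ F * k
  ∑-*ʳ F k = go vertices
    where
    go : ∀ xs → sum (map (λ v → F v * k) xs) ≡ sum (map F xs) * k
    go []       = refl
    go (x ∷ xs) = trans (cong (F x * k +_) (go xs)) (sym (*-distribʳ-+ k (F x) _))

  ∑-1 : ∑ (λ _ → 1) ≡ order Γ
  ∑-1 = go vertices
    where
    go : (xs : List V) → sum (map (λ _ → 1) xs) ≡ length xs
    go []       = refl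
    go (x ∷ xs) = cong suc (go xs)

  ∑-ind : {P : Pred V 0ℓ} (P? : Decidable P) → ∑ (ind ∘ P?) ≡ count P?
  ∑-ind P? = go vertices
    where
    go : ∀ xs → sum (map (ind ∘ P?) xs) ≡ length (filter P? xs)
    go []       = refl
    go (x ∷ xs) with P? x
    ... | yes _ = cong suc (go xs)
    ... | no _  = go xs

  -- `complete` gives an occurrence of `v` in the list and `unique` excludes a second one. Later
  -- counts of single vertices reduce to this sum.
  ∑-ind-≟ : ∀ v → ∑ (λ w → ind (w ≟ v)) ≡ 1
  ∑-ind-≟ v = go unique (complete v)
    where
    absent : ∀ {xs} → All (v ≢_) xs → sum (map (λ w → ind (w ≟ v)) xs) ≡ 0
    absent []                = refl
    absent (_∷_ {x} v≢x v≢xs) with x ≟ v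
    ... | yes refl = ⊥-elim (v≢x refl)
    ... | no _     = absent v≢xs

    go : ∀ {xs} → Unique xs → v ∈ xs → sum (map (λ w → ind (w ≟ v)) xs) ≡ 1
    go (v≢xs ∷ _) (here refl) with v ≟ v
    ... | yes _  = cong suc (absent v≢xs)
    ... | no v≢v = ⊥-elim (v≢v refl)
    go {x ∷ _} (x≢xs ∷ u) (there v∈xs) with x ≟ v
    ... | yes refl = ⊥-elim (All.lookup x≢xs v∈xs refl)
    ... | no _     = go u v∈xs

  ∑-ind-≟-* : ∀ v k → ∑ (λ w → ind (w ≟ v) * k) ≡ k
  ∑-ind-≟-* v k = trans (∑-*ʳ _ k) (trans (cong (_* k) (∑-ind-≟ v)) (*-identityˡ k))

  -- `F` dominates pointwise the function that is `F v` at `v` and 0 elsewhere, whose sum is `F v`.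
  -- For two terms, `u ≢ v` keeps the supports disjoint.
  term≤∑ : (F : V → ℕ) (v : V) → F v ≤ ∑ F
  term≤∑ F v = subst (_≤ ∑ F) (∑-ind-≟-* v (F v)) (∑-mono pointwise)
    where
    pointwise : ∀ w → ind (w ≟ v) * F v ≤ F w
    pointwise w with w ≟ v
    ... | yes refl = ≤-reflexive (*-identityˡ (F v))
    ... | no _     = z≤n

  terms≤∑ : (F : V → ℕ) {u v : V} → u ≢ v → F u + F v ≤ ∑ F
  terms≤∑ F {u} {v} u≢v = subst (_≤ ∑ F)
    (trans (∑-+ _ _) (cong₂ _+_ (∑-ind-≟-* u (F u)) (∑-ind-≟-* v (F v))))
    (∑-mono pointwise)
    where
    pointwise : ∀ w → ind (w ≟ u) * F u + ind (w ≟ v) * F v ≤ F w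
    pointwise w with w ≟ u | w ≟ v
    ... | yes refl | yes w≡v  = ⊥-elim (u≢v w≡v)
    ... | yes refl | no _     = ≤-reflexive (trans (+-identityʳ _) (*-identityˡ (F w)))
    ... | no _     | yes refl = ≤-reflexive (*-identityˡ (F w))
    ... | no _     | no _     = z≤n

  -- Search and counting

  any-vertex? : {P : Pred V 0ℓ} → Decidable P → Dec (∃ P)
  any-vertex? P? = map′ satisfied (λ (v , p) → lose (complete v) p) (any? P? vertices)

  count-≟ : ∀ v → count (_≟ v) ≡ 1
  count-≟ v = trans (sym (∑-ind (_≟ v))) (∑-ind-≟ v)

  count-⊎ : ∀ {u v} → u ≢ v → count (λ w → w ≟ u ⊎-dec w ≟ v) ≡ 2
  count-⊎ {u} {v} u≢v =
    trans (sym (∑-ind _))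
    (trans (∑-cong pointwise)
    (trans (∑-+ _ _) (cong₂ _+_ (∑-ind-≟ u) (∑-ind-≟ v))))
    where
    pointwise : ∀ w → ind (w ≟ u ⊎-dec w ≟ v) ≡ ind (w ≟ u) + ind (w ≟ v)
    pointwise w with w ≟ u | w ≟ v
    ... | yes refl | yes w≡v = ⊥-elim (u≢v w≡v)
    ... | yes _    | no _    = refl
    ... | no _     | yes _   = refl
    ... | no _     | no _    = refl

  count≤1 : {P : Pred V 0ℓ} (P? : Decidable P) (v : V) → (∀ w → P w → w ≡ v) → count P? ≤ 1
  count≤1 P? v only = subst (_≤ 1) (∑-ind P?) (≤-trans (∑-mono pointwise) (≤-reflexive (∑-ind-≟ v)))
    where
    pointwise : ∀ w → ind (P? w) ≤ ind (w ≟ v)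
    pointwise w with P? w | w ≟ v
    ... | yes _ | yes _  = ≤-refl
    ... | yes p | no w≢v = ⊥-elim (w≢v (only w p))
    ... | no _  | _      = z≤n

  count≡1⇒unique : {P : Pred V 0ℓ} (P? : Decidable P) → count P? ≡ 1 →
    Σ[ v ∈ V ] P v × (∀ w → P w → w ≡ v)
  count≡1⇒unique P? count≡1 with filter P? vertices in eq
  count≡1⇒unique P? refl | v ∷ [] =
      v
    , proj₂ (∈-filter⁻ P? {xs = vertices} (subst (v ∈_) (sym eq) (here refl)))
    , λ w p → ∈-singleton (subst (w ∈_) eq (∈-filter⁺ P? (complete w) p))
    where
    ∈-singleton : ∀ {w} → w ∈ v ∷ [] → w ≡ v
    ∈-singleton (here w≡v) = w≡v

  -- If every vertex were `v`, the constant 1 would lie below the indicator of `v`, and the order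
  -- would be at most 1.
  another-vertex : Nontrivial Γ → ∀ v → Σ[ w ∈ V ] w ≢ v
  another-vertex 2≤n v with any-vertex? (λ w → ¬? (w ≟ v))
  ... | yes w≢v = w≢v
  ... | no none = ⊥-elim (<⇒≱ 2≤n (≤-trans (≤-reflexive (sym ∑-1))
          (≤-trans (∑-mono pointwise) (≤-reflexive (∑-ind-≟ v)))))
    where
    pointwise : ∀ w → 1 ≤ ind (w ≟ v)
    pointwise w with w ≟ v
    ... | yes _  = ≤-refl
    ... | no w≢v = ⊥-elim (none (w , w≢v))

  -- A dominating set of size 1 has a single element, so that element is the neighbour which
  -- domination promises to each other vertex.
  universal-vertex : IsDominationNumber Γ 1 → Σ[ c ∈ V ] (∀ v → v ≢ c → Adj v c)
  universal-vertex ((S , dominating , size≡1) , _) with count≡1⇒unique (λ v → T? (S v)) size≡1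
  ... | c , c∈S , only = c , adjacent
    where
    adjacent : ∀ v → v ≢ c → Adj v c
    adjacent v v≢c with dominating v (v≢c ∘ only v)
    ... | w , vw , w∈S = subst (Adj v) (only w w∈S) vw

  -- Extremal degrees

  degree≤Δ : ∀ v → degree v ≤ Δ Γ
  degree≤Δ v = All.lookup (xs≤max 0 (map degree vertices)) (∈-map⁺ degree (complete v))

  δ≤degree : ∀ v → δ Γ ≤ degree v
  δ≤degree v = All.lookup (min≤xs (degree point) (map degree vertices)) (∈-map⁺ degree (complete v))

  Δ≤order : Δ Γ ≤ order Γ
  Δ≤order = max≤v⁺ z≤n (All.map⁺ (All.universal (λ v → length-filter (adj? v) vertices) vertices))

  Δ-attained : Σ[ v ∈ V ] degree v ≡ Δ Γ
  Δ-attained with argmax-sel (λ k → k) 0 (map degree vertices)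
  -- If the maximum is the base value 0, every degree is 0 and `point` attains it.
  ... | inj₁ Δ≡0 = point , ≤-antisym (degree≤Δ point) (subst (_≤ degree point) (sym Δ≡0) z≤n)
  ... | inj₂ Δ∈  with ∈-map⁻ degree Δ∈
  ...   | v , _ , Δ≡ = v , sym Δ≡

  δ-attained : Σ[ v ∈ V ] degree v ≡ δ Γ
  δ-attained with argmin-sel (λ k → k) (degree point) (map degree vertices)
  ... | inj₁ δ≡ = point , sym δ≡
  ... | inj₂ δ∈ with ∈-map⁻ degree δ∈
  ...   | v , _ , δ≡ = v , sym δ≡

  -- Lower bounds for the weight of a labelling of one graph

  order≤weight : (g : V → Fin 3) → (∀ v → g v ≢ 0F) → order Γ ≤ weight g
  order≤weight g g≢0 = subst (_≤ weight g) ∑-1 (∑-mono (λ v → 1≤toℕ (g≢0 v)))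

  order<weight : (g : V → Fin 3) → (∀ v → g v ≢ 0F) → (y : V) → g y ≡ 2F → order Γ + 1 ≤ weight g
  order<weight g g≢0 y gy≡2 = subst (_≤ weight g)
    (trans (∑-+ _ _) (cong₂ _+_ ∑-1 (∑-ind-≟ y))) (∑-mono pointwise)
    where
    pointwise : ∀ v → 1 + ind (v ≟ y) ≤ toℕ (g v)
    pointwise v with v ≟ y
    ... | yes refl rewrite gy≡2 = ≤-refl
    ... | no _     = 1≤toℕ (g≢0 v)

  -- Adding the indicator of the neighbours of `y` to `g` lifts every zero to 1, while `y` itself
  -- counts 2. Keeping the degree on the right avoids truncated subtraction.
  closed-star-bound : (g : V → Fin 3) (y : V) → g y ≡ 2F →
    (∀ v → g v ≡ 0F → Adj y v) → order Γ + 1 ≤ weight g + degree y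
  closed-star-bound g y gy≡2 zeros = begin
    order Γ + 1                                 ≡⟨ cong₂ _+_ ∑-1 (∑-ind-≟ y) ⟨
    ∑ (λ _ → 1) + ∑ (λ v → ind (v ≟ y))         ≡⟨ ∑-+ _ _ ⟨
    ∑ (λ v → 1 + ind (v ≟ y))                   ≤⟨ ∑-mono pointwise ⟩
    ∑ (λ v → toℕ (g v) + ind (adj? y v))        ≡⟨ ∑-+ _ _ ⟩
    weight g + ∑ (λ v → ind (adj? y v))         ≡⟨ cong (weight g +_) (∑-ind (adj? y)) ⟩
    weight g + degree y                         ∎
    where
    open ≤-Reasoning
    pointwise : ∀ v → 1 + ind (v ≟ y) ≤ toℕ (g v) + ind (adj? y v)
    pointwise v with v ≟ y
    ... | yes refl rewrite gy≡2 = m≤m+n 2 _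
    ... | no _ with g v in gv≡ | adj? y v
    ...   | 0F    | yes _ = ≤-refl
    ...   | 0F    | no ¬a = ⊥-elim (¬a (zeros v gv≡))
    ...   | suc _ | _     = s≤s z≤n

  -- The centre contributes 2, and each of its neighbours, being nonzero, at least 1.
  open-star-bound : (g : V → Fin 3) (y : V) → g y ≡ 2F →
    (∀ v → g v ≡ 0F → ¬ Adj y v) → degree y + 2 ≤ weight g
  open-star-bound g y gy≡2 zeros = begin
    degree y + 2                                               ≡⟨ cong₂ _+_ (∑-ind (adj? y)) (∑-ind-≟-* y 2) ⟨
    ∑ (λ v → ind (adj? y v)) + ∑ (λ v → ind (v ≟ y) * 2)       ≡⟨ ∑-+ _ _ ⟨
    ∑ (λ v → ind (adj? y v) + ind (v ≟ y) * 2)                 ≤⟨ ∑-mono pointwise ⟩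
    weight g                                                   ∎
    where
    open ≤-Reasoning
    pointwise : ∀ v → ind (adj? y v) + ind (v ≟ y) * 2 ≤ toℕ (g v)
    pointwise v with v ≟ y | adj? y v
    ... | yes refl | yes a = ⊥-elim (adj-irrefl a)
    ... | yes refl | no _  rewrite gy≡2 = ≤-refl
    ... | no _     | yes a = 1≤toℕ (λ gv≡0 → zeros v gv≡0 a)
    ... | no _     | no _  = z≤n

  -- Star labellings for which the two star bounds are equalities

  closedStar : V → V → Fin 3
  closedStar y v with v ≟ y | adj? y v
  ... | yes _ | _     = 2F
  ... | no _  | yes _ = 0F
  ... | no _  | no _  = 1F

  closedStar-centre : ∀ y → closedStar y y ≡ 2F
  closedStar-centre y with y ≟ y
  ... | yes _  = refl
  ... | no y≢y = ⊥-elim (y≢y refl)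

  closedStar-2 : ∀ y v → closedStar y v ≡ 2F → v ≡ y
  closedStar-2 y v e with v ≟ y | adj? y v
  closedStar-2 y v e  | yes v≡y | _     = v≡y
  closedStar-2 y v () | no _    | yes _
  closedStar-2 y v () | no _    | no _

  closedStar-0 : ∀ y v → closedStar y v ≡ 0F → Adj y v
  closedStar-0 y v e with v ≟ y | adj? y v
  closedStar-0 y v () | yes _ | _
  closedStar-0 y v e  | no _  | yes a = a
  closedStar-0 y v () | no _  | no _

  closedStar-weight : ∀ y → weight (closedStar y) + degree y ≡ order Γ + 1
  closedStar-weight y =
    trans (cong (weight (closedStar y) +_) (sym (∑-ind (adj? y))))
    (trans (sym (∑-+ _ _))
    (trans (∑-cong pointwise)
    (trans (∑-+ _ _) (cong₂ _+_ ∑-1 (∑-ind-≟ y)))))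
    where
    pointwise : ∀ v → toℕ (closedStar y v) + ind (adj? y v) ≡ 1 + ind (v ≟ y)
    pointwise v with v ≟ y | adj? y v
    ... | yes refl | yes a = ⊥-elim (adj-irrefl a)
    ... | yes _    | no _  = refl
    ... | no _     | yes _ = refl
    ... | no _     | no _  = refl

  openStar : V → V → Fin 3
  openStar y v with v ≟ y | adj? y v
  ... | yes _ | _     = 2F
  ... | no _  | yes _ = 1F
  ... | no _  | no _  = 0F

  openStar-centre : ∀ y → openStar y y ≡ 2F
  openStar-centre y with y ≟ y
  ... | yes _  = refl
  ... | no y≢y = ⊥-elim (y≢y refl)

  openStar-2 : ∀ y v → openStar y v ≡ 2F → v ≡ y
  openStar-2 y v e with v ≟ y | adj? y v
  openStar-2 y v e  | yes v≡y | _     = v≡y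
  openStar-2 y v () | no _    | yes _
  openStar-2 y v () | no _    | no _

  openStar-0 : ∀ y v → openStar y v ≡ 0F → ¬ Adj y v
  openStar-0 y v e with v ≟ y | adj? y v
  openStar-0 y v () | yes _ | _
  openStar-0 y v () | no _  | yes _
  openStar-0 y v e  | no _  | no ¬a = ¬a

  openStar-weight : ∀ y → weight (openStar y) ≡ degree y + 2
  openStar-weight y =
    trans (∑-cong pointwise)
    (trans (∑-+ _ _) (cong₂ _+_ (∑-ind (adj? y)) (∑-ind-≟-* y 2)))
    where
    pointwise : ∀ v → toℕ (openStar y v) ≡ ind (adj? y v) + ind (v ≟ y) * 2
    pointwise v with v ≟ y | adj? y v
    ... | yes refl | yes a = ⊥-elim (adj-irrefl a)
    ... | yes _    | no _  = refl
    ... | no _     | yes _ = refl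
    ... | no _     | no _  = refl

-- Fibres of the lexicographic product

module Lexicographic (G H : Graph) where
  module G = GraphProperties G
  module H = GraphProperties H
  module GH = Graph (G ∘ₗ H)

  weight-fibres : (f : G.V × H.V → Fin 3) →
    GH.weight f ≡ G.∑ (λ u → H.weight (λ v → f (u , v)))
  weight-fibres f = sum-map-cartesianProduct (toℕ ∘ f) G.vertices H.vertices

  fibre≤weight : (f : G.V × H.V → Fin 3) (u : G.V) → H.weight (λ v → f (u , v)) ≤ GH.weight f
  fibre≤weight f u = ≤-trans (G.term≤∑ _ u) (≤-reflexive (sym (weight-fibres f)))

  fibres≤weight : (f : G.V × H.V → Fin 3) {u w : G.V} → u ≢ w →
    H.weight (λ v → f (u , v)) + H.weight (λ v → f (w , v)) ≤ GH.weight f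
  fibres≤weight f u≢w = ≤-trans (G.terms≤∑ _ u≢w) (≤-reflexive (sym (weight-fibres f)))

  module _ {P : Pred G.V 0ℓ} (P? : Decidable P) (g : H.V → Fin 3) where

    copies : G.V × H.V → Fin 3
    copies (u , v) = restrict (P? u) (g v)

    copies-weight : GH.weight copies ≡ G.count P? * H.weight g
    copies-weight =
      trans (weight-fibres copies)
      (trans (G.∑-cong fibre)
      (trans (G.∑-*ʳ (ind ∘ P?) (H.weight g)) (cong (_* H.weight g) (G.∑-ind P?))))
      where
      fibre : ∀ u → H.weight (λ v → copies (u , v)) ≡ ind (P? u) * H.weight g
      fibre u with P? u
      ... | yes _ = sym (*-identityˡ _)
      -- The label 0 is read as the product `0 * 0`, so that `∑-*ʳ` takes a factor 0 out of the sum.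
      ... | no _  = trans (H.∑-*ʳ (λ _ → 0) 0) (*-zeroʳ (H.∑ (λ _ → 0)))

  -- Perfect Roman dominating functions built from stars

  module _ (c : G.V) (universal : ∀ u → u ≢ c → G.Adj u c) (h : H.V) where

    universalCopy : G.V × H.V → Fin 3
    universalCopy = copies (G._≟ c) (H.closedStar h)

    -- The only 2 is at `(c , h)`. Other fibres see it because `c` is universal; within the fibre of
    -- `c` the zeros are neighbours of `h`.
    universalCopy-PRDF : GH.PRDF universalCopy
    universalCopy-PRDF (u , v) e = (c , h) , (adjacent (restrict-0 (u G.≟ c) e) , centre) , only
      where
      centre : universalCopy (c , h) ≡ 2F
      centre = trans (restrict-yes (c G.≟ c) refl) (H.closedStar-centre h)

      adjacent : u ≢ c ⊎ (u ≡ c × H.closedStar h v ≡ 0F) → GH.Adj (u , v) (c , h)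
      adjacent (inj₁ u≢c)       = inj₁ (universal u u≢c)
      adjacent (inj₂ (u≡c , 0≡)) = inj₂ (u≡c , H.adj-sym (H.closedStar-0 h v 0≡))

      only : ∀ {q} → GH.Adj (u , v) q × universalCopy q ≡ 2F → (c , h) ≡ q
      only {p , q} (_ , 2≡) with restrict-2 (p G.≟ c) 2≡
      ... | p≡c , 2≡′ = cong₂ _,_ (sym p≡c) (sym (H.closedStar-2 h q 2≡′))

    universalCopy-weight : GH.weight universalCopy + H.degree h ≡ order H + 1
    universalCopy-weight = trans (cong (_+ H.degree h) weight≡) (H.closedStar-weight h)
      where
      weight≡ : GH.weight universalCopy ≡ H.weight (H.closedStar h)
      weight≡ = trans (copies-weight (G._≟ c) (H.closedStar h))
        (trans (cong (_* H.weight (H.closedStar h)) (G.count-≟ c)) (*-identityˡ _))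

  module _ {l x : G.V} (lx : G.Adj l x) (leaf : ∀ u → G.Adj l u → u ≡ x)
           (universal : ∀ u → u ≢ x → G.Adj u x) (h : H.V) where

    edge? : Decidable (λ u → u ≡ x ⊎ u ≡ l)
    edge? u = u G.≟ x ⊎-dec u G.≟ l

    edgeCopies : G.V × H.V → Fin 3
    edgeCopies = copies edge? (H.openStar h)

    -- The 2s are `(x , h)` and `(l , h)`. Outside their fibres only `(x , h)` is seen, since the
    -- leaf `l` has no neighbour but `x`. A zero inside one of the two fibres is not adjacent to the
    -- 2 of its own fibre, so it sees only the 2 of the other.
    edgeCopies-PRDF : GH.PRDF edgeCopies
    edgeCopies-PRDF (u , v) e = dominator (restrict-0 (edge? u) e)
      where
      centre : ∀ {u} → u ≡ x ⊎ u ≡ l → edgeCopies (u , h) ≡ 2F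
      centre {u} uxl = trans (restrict-yes (edge? u) uxl) (H.openStar-centre h)

      centres : ∀ {p q} → edgeCopies (p , q) ≡ 2F → (p ≡ x ⊎ p ≡ l) × q ≡ h
      centres {p} {q} 2≡ with restrict-2 (edge? p) 2≡
      ... | pxl , 2≡′ = pxl , H.openStar-2 h q 2≡′

      not-own : H.openStar h v ≡ 0F → ∀ {p} → ¬ GH.Adj (p , v) (p , h)
      not-own 0≡ (inj₁ pp)       = G.adj-irrefl pp
      not-own 0≡ (inj₂ (_ , vh)) = H.openStar-0 h v 0≡ (H.adj-sym vh)

      dominator : ¬ (u ≡ x ⊎ u ≡ l) ⊎ ((u ≡ x ⊎ u ≡ l) × H.openStar h v ≡ 0F) →
        ∃! _≡_ (λ z → GH.Adj (u , v) z × edgeCopies z ≡ 2F)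
      dominator (inj₁ u≢xl) =
        (x , h) , (inj₁ (universal u (u≢xl ∘ inj₁)) , centre (inj₁ refl)) , only
        where
        only : ∀ {q} → GH.Adj (u , v) q × edgeCopies q ≡ 2F → (x , h) ≡ q
        only (a , 2≡) with centres 2≡
        only (a , 2≡)              | inj₁ refl , refl = refl
        only (inj₁ ul , 2≡)        | inj₂ refl , refl = ⊥-elim (u≢xl (inj₁ (leaf u (G.adj-sym ul))))
        only (inj₂ (u≡l , _) , 2≡) | inj₂ refl , refl = ⊥-elim (u≢xl (inj₂ u≡l))
      dominator (inj₂ (inj₁ refl , 0≡)) =
        (l , h) , (inj₁ (G.adj-sym lx) , centre (inj₂ refl)) , only
        where
        only : ∀ {q} → GH.Adj (u , v) q × edgeCopies q ≡ 2F → (l , h) ≡ q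
        only (a , 2≡) with centres 2≡
        ... | inj₁ refl , refl = ⊥-elim (not-own 0≡ a)
        ... | inj₂ refl , refl = refl
      dominator (inj₂ (inj₂ refl , 0≡)) =
        (x , h) , (inj₁ lx , centre (inj₁ refl)) , only
        where
        only : ∀ {q} → GH.Adj (u , v) q × edgeCopies q ≡ 2F → (x , h) ≡ q
        only (a , 2≡) with centres 2≡
        ... | inj₁ refl , refl = refl
        ... | inj₂ refl , refl = ⊥-elim (not-own 0≡ a)

    edgeCopies-weight : GH.weight edgeCopies ≡ 2 * (H.degree h + 2)
    edgeCopies-weight = trans (copies-weight edge? (H.openStar h))
      (cong₂ _*_ (G.count-⊎ x≢l) (H.openStar-weight h))
      where
      x≢l : x ≢ l
      x≢l refl = G.adj-irrefl lx

  -- Lower bounds for an arbitrary perfect Roman dominating function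

  module _ (nontrivial : Nontrivial G) (c : G.V) (universal : ∀ u → u ≢ c → G.Adj u c)
           (f : G.V × H.V → Fin 3) (prdf : GH.PRDF f) where

    private
      fibre : G.V → H.V → Fin 3
      fibre u v = f (u , v)

      same : ∀ {z p q} → f z ≡ 0F → GH.Adj z p → f p ≡ 2F → GH.Adj z q → f q ≡ 2F → p ≡ q
      same fz≡0 zp fp≡2 zq fq≡2 with prdf _ fz≡0
      ... | _ , _ , only = trans (sym (only (zp , fp≡2))) (only (zq , fq≡2))

    -- The fibre of `u` alone gives `order H`. To gain one more, a vertex of another fibre is
    -- inspected: if it is labelled 0, the 2 that it sees lies either outside the fibre of `u`,
    -- adding weight there, or inside it, exceeding the 1 already counted.
    zero-free-bound : (u : G.V) → (∀ v → fibre u v ≢ 0F) → order H + 1 ≤ GH.weight f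
    zero-free-bound u u≢0 with G.another-vertex nontrivial u
    ... | w , w≢u = byValue (f (w , H.point) Fin.≟ 0F)
      where
      nonzero : ∀ {x} → x ≢ u → ∀ y → f (x , y) ≢ 0F → order H + 1 ≤ GH.weight f
      nonzero {x} x≢u y fxy≢0 = ≤-trans
        (+-mono-≤ (H.order≤weight (fibre u) u≢0)
                  (≤-trans (1≤toℕ fxy≢0) (H.term≤∑ (toℕ ∘ fibre x) y)))
        (fibres≤weight f (x≢u ∘ sym))

      byValue : Dec (f (w , H.point) ≡ 0F) → order H + 1 ≤ GH.weight f
      byValue (no ≢0) = nonzero w≢u H.point ≢0
      byValue (yes ≡0) with prdf (w , H.point) ≡0
      ... | (x , y) , (_ , fxy≡2) , _ with x G.≟ u
      ...   | no x≢u   = nonzero x≢u y (2≢0 fxy≡2)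
        where
        2≢0 : ∀ {k : Fin 3} → k ≡ 2F → k ≢ 0F
        2≢0 refl ()
      ...   | yes refl = ≤-trans (H.order<weight (fibre u) u≢0 y fxy≡2) (fibre≤weight f u)

    closed-fibre-bound : ∀ u y → f (u , y) ≡ 2F → (∀ v → f (u , v) ≡ 0F → H.Adj y v) →
      (order H ∸ Δ H) + 1 ≤ GH.weight f
    closed-fibre-bound u y fuy≡2 zeros = begin
      -- Moving the 1 across the truncated subtraction relies on `Δ H ≤ order H`.
      (order H ∸ Δ H) + 1   ≡⟨ +-∸-comm 1 H.Δ≤order ⟨
      (order H + 1) ∸ Δ H   ≤⟨ m≤n+o⇒m∸n≤o (order H + 1) (Δ H) bound ⟩
      GH.weight f           ∎
      where
      open ≤-Reasoning
      bound : order H + 1 ≤ Δ H + GH.weight f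
      bound = begin
        order H + 1                      ≤⟨ H.closed-star-bound (fibre u) y fuy≡2 zeros ⟩
        H.weight (fibre u) + H.degree y  ≤⟨ +-mono-≤ (fibre≤weight f u) (H.degree≤Δ y) ⟩
        GH.weight f + Δ H                ≡⟨ +-comm (GH.weight f) (Δ H) ⟩
        Δ H + GH.weight f                ∎

    open-fibres-bound : ∀ {u w a b} → u ≢ w → f (u , a) ≡ 2F → f (w , b) ≡ 2F →
      (∀ v → f (u , v) ≡ 0F → ¬ H.Adj a v) → (∀ v → f (w , v) ≡ 0F → ¬ H.Adj b v) →
      2 * δ H + 4 ≤ GH.weight f
    open-fibres-bound {u} {w} {a} {b} u≢w fua≡2 fwb≡2 zeros-u zeros-w = begin
      2 * δ H + 4                                   ≡⟨ *-distribˡ-+ 2 (δ H) 2 ⟨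
      2 * (δ H + 2)                                 ≡⟨ cong (δ H + 2 +_) (+-identityʳ (δ H + 2)) ⟩
      (δ H + 2) + (δ H + 2)                         ≤⟨ +-mono-≤ (star a fua≡2 zeros-u) (star b fwb≡2 zeros-w) ⟩
      H.weight (fibre u) + H.weight (fibre w)       ≤⟨ fibres≤weight f u≢w ⟩
      GH.weight f                                   ∎
      where
      open ≤-Reasoning
      star : ∀ {z} y → f (z , y) ≡ 2F → (∀ v → f (z , v) ≡ 0F → ¬ H.Adj y v) →
        δ H + 2 ≤ H.weight (fibre z)
      star {z} y fzy≡2 zeros =
        ≤-trans (+-monoˡ-≤ 2 (H.δ≤degree y)) (H.open-star-bound (fibre z) y fzy≡2 zeros)

    -- The cases follow the 2 at `(x , y)` seen by a zero over `c`: `x` is `c`; or it is not, and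
    -- the fibre of `c` has no 2 or has one. The second alternative of the conclusion records that
    -- `x` has no neighbour but `c`, which is impossible when the minimum degree is at least 2.
    zeros-bound : (∀ u → Σ[ v ∈ H.V ] f (u , v) ≡ 0F) →
      ((order H ∸ Δ H) + 1 ≤ GH.weight f)
      ⊎ (Σ[ x ∈ G.V ] (∀ w → G.Adj x w → w ≡ c) × 2 * δ H + 4 ≤ GH.weight f)
    zeros-bound zero-in with prdf (c , proj₁ (zero-in c)) (proj₂ (zero-in c))
    ... | (x , y) , (_ , fxy≡2) , only-xy with x G.≟ c
    ...   | yes refl = inj₁ (closed-fibre-bound c y fxy≡2 zeros)
      where
      -- The chosen zero over `c` is adjacent to all other fibres, so a 2 there would be a second
      -- one in its sight.
      elsewhere : ∀ {p q} → p ≢ c → f (p , q) ≢ 2F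
      elsewhere {p} p≢c fpq≡2 =
        p≢c (sym (cong proj₁ (only-xy (inj₁ (G.adj-sym (universal p p≢c)) , fpq≡2))))

      -- A zero over any other vertex of `G` sees the entire fibre of `c`, which therefore holds at
      -- most one 2.
      same-fibre : ∀ {q} → f (c , q) ≡ 2F → q ≡ y
      same-fibre fcq≡2 with G.another-vertex nontrivial c
      ... | w , w≢c = cong proj₂ (same (proj₂ (zero-in w))
              (inj₁ (universal w w≢c)) fcq≡2 (inj₁ (universal w w≢c)) fxy≡2)

      zeros : ∀ v → f (c , v) ≡ 0F → H.Adj y v
      zeros v fcv≡0 with prdf (c , v) fcv≡0
      ... | (p , q) , (a , fpq≡2) , _ with p G.≟ c
      ...   | no p≢c   = ⊥-elim (elsewhere p≢c fpq≡2)
      ...   | yes refl with a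
      ...     | inj₁ cc       = ⊥-elim (G.adj-irrefl cc)
      ...     | inj₂ (_ , vq) = H.adj-sym (subst (H.Adj v) (same-fibre fpq≡2) vq)
    zeros-bound zero-in | (x , y) , (_ , fxy≡2) , only-xy | no x≢c
      with H.any-vertex? (λ a → f (c , a) Fin.≟ 2F)
    ... | no none = inj₁ (closed-fibre-bound x y fxy≡2 zeros)
      where
      zeros : ∀ v → f (x , v) ≡ 0F → H.Adj y v
      zeros v fxv≡0 with prdf (x , v) fxv≡0
      ... | (p , q) , (a , fpq≡2) , _ with p G.≟ c
      ...   | yes refl = ⊥-elim (none (q , fpq≡2))
      ...   | no p≢c with only-xy (inj₁ (G.adj-sym (universal p p≢c)) , fpq≡2) | a
      ...     | refl | inj₁ xx       = ⊥-elim (G.adj-irrefl xx)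
      ...     | refl | inj₂ (_ , vy) = H.adj-sym vy
    ... | yes (a , fca≡2) = inj₂ (x , leaf ,
            open-fibres-bound (x≢c ∘ sym) fca≡2 fxy≡2 zeros-c zeros-x)
      where
      xc : G.Adj x c
      xc = universal x x≢c

      sees-one : ∀ {z} → f z ≡ 0F → GH.Adj z (x , y) → ¬ GH.Adj z (c , a)
      sees-one fz≡0 z~xy z~ca = x≢c (cong proj₁ (same fz≡0 z~xy fxy≡2 z~ca fca≡2))

      -- A zero over a common neighbour `w` of `x` and `c` would see both 2s.
      leaf : ∀ w → G.Adj x w → w ≡ c
      leaf w xw = decidable-stable (w G.≟ c) λ w≢c →
        sees-one (proj₂ (zero-in w)) (inj₁ (G.adj-sym xw)) (inj₁ (universal w w≢c))

      zeros-c : ∀ v → f (c , v) ≡ 0F → ¬ H.Adj a v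
      zeros-c v fcv≡0 av = sees-one fcv≡0 (inj₁ (G.adj-sym xc)) (inj₂ (refl , H.adj-sym av))

      zeros-x : ∀ v → f (x , v) ≡ 0F → ¬ H.Adj y v
      zeros-x v fxv≡0 yv = sees-one fxv≡0 (inj₂ (refl , H.adj-sym yv)) (inj₁ xc)

    zero-in? : ∀ u → Dec (Σ[ v ∈ H.V ] f (u , v) ≡ 0F)
    zero-in? u = H.any-vertex? (λ v → f (u , v) Fin.≟ 0F)

    PRDF-bound : ((order H ∸ Δ H) + 1 ≤ GH.weight f)
      ⊎ (Σ[ x ∈ G.V ] (∀ w → G.Adj x w → w ≡ c) × 2 * δ H + 4 ≤ GH.weight f)
    PRDF-bound with G.any-vertex? (λ u → ¬? (zero-in? u))
    -- A zero-free fibre gives even `order H + 1`, from which `Δ H` may be dropped.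
    ... | yes (u , none) = inj₁ (≤-trans (+-monoˡ-≤ 1 (m∸n≤m (order H) (Δ H)))
                                         (zero-free-bound u (λ v fuv≡0 → none (v , fuv≡0))))
    ... | no every = zeros-bound (λ u → decidable-stable (zero-in? u) (λ none → every (u , none)))

  -- Extremal choices of the star centre in `H`, and the two cases of the theorem

  universalCopy-attains : (c : G.V) → (∀ u → u ≢ c → G.Adj u c) →
    Σ[ f ∈ (G.V × H.V → Fin 3) ] GH.PRDF f × GH.weight f ≡ (order H ∸ Δ H) + 1
  universalCopy-attains c universal with H.Δ-attained
  ... | h , degree≡Δ = universalCopy c universal h , universalCopy-PRDF c universal h , weight≡
    where
    open ≤-Reasoning
    W : ℕ
    W = GH.weight (universalCopy c universal h)
    weight≡ : W ≡ (order H ∸ Δ H) + 1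
    weight≡ = begin-equality
      W                       ≡⟨ m+n∸n≡m W (Δ H) ⟨
      W + Δ H ∸ Δ H           ≡⟨ cong (λ d → W + d ∸ Δ H) degree≡Δ ⟨
      W + H.degree h ∸ Δ H    ≡⟨ cong (_∸ Δ H) (universalCopy-weight c universal h) ⟩
      (order H + 1) ∸ Δ H     ≡⟨ +-∸-comm 1 H.Δ≤order ⟩
      (order H ∸ Δ H) + 1     ∎

  edgeCopies-attain : {l x : G.V} → G.Adj l x → (∀ u → G.Adj l u → u ≡ x) →
    (∀ u → u ≢ x → G.Adj u x) →
    Σ[ f ∈ (G.V × H.V → Fin 3) ] GH.PRDF f × GH.weight f ≡ 2 * δ H + 4
  edgeCopies-attain lx leaf universal with H.δ-attained
  ... | h , degree≡δ = edgeCopies lx leaf universal h , edgeCopies-PRDF lx leaf universal h ,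
    trans (edgeCopies-weight lx leaf universal h)
    (trans (cong (λ d → 2 * (d + 2)) degree≡δ) (*-distribˡ-+ 2 (δ H) 2))

-- If `l` is not `c`, then `c` is a neighbour of `l`, hence `c` is `x`. If `l` is `c`, every other
-- vertex is a neighbour of `l` and hence equals `x`, so `G` is a single edge.
leaf-neighbour-universal : (G : Graph) → let open Graph G in {c l x : V} →
  (∀ u → u ≢ c → Adj u c) → Adj l x → (∀ u → Adj l u → u ≡ x) → ∀ u → u ≢ x → Adj u x
leaf-neighbour-universal G {c} {l} {x} universal lx leaf u u≢x = go (l ≟ c) (u ≟ c)
  where
  open Graph G
  go : Dec (l ≡ c) → Dec (u ≡ c) → Adj u x
  go (no l≢c)   _          = subst (Adj u) c≡x (universal u (λ u≡c → u≢x (trans u≡c c≡x)))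
    where
    c≡x : c ≡ x
    c≡x = leaf c (universal l l≢c)
  go (yes refl) (yes refl) = lx
  go (yes refl) (no u≢c)   = ⊥-elim (u≢x (leaf u (adj-sym (universal u u≢c))))

theorem4p5 : (G : Graph) → Nontrivial G → IsDominationNumber G 1 →
    (2 ≤ δ G → (H : Graph) →
    IsPerfectRomanDominationNumber (G ∘ₗ H) ((order H ∸ Δ H) + 1))
    × (δ G ≡ 1 → (H : Graph) →
    IsPerfectRomanDominationNumber (G ∘ₗ H) ((2 * δ H + 4) ⊓ ((order H ∸ Δ H) + 1)))
theorem4p5 G nontrivial γ≡1 with GraphProperties.universal-vertex G γ≡1
... | c , universal = min-degree≥2 , min-degree≡1
  where
  module G = GraphProperties G

  min-degree≥2 : 2 ≤ δ G → (H : Graph) →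
    IsPerfectRomanDominationNumber (G ∘ₗ H) ((order H ∸ Δ H) + 1)
  min-degree≥2 2≤δ H = universalCopy-attains c universal , lower
    where
    open Lexicographic G H using (module GH; universalCopy-attains; PRDF-bound)
    lower : ∀ f → GH.PRDF f → (order H ∸ Δ H) + 1 ≤ GH.weight f
    lower f prdf with PRDF-bound nontrivial c universal f prdf
    ... | inj₁ bound          = bound
    ... | inj₂ (x , leaf , _) =
      -- All neighbours of `x` equal `c`, so its degree is at most 1, against the minimum degree of
      -- at least 2.
      ⊥-elim (<⇒≱ (≤-trans 2≤δ (G.δ≤degree x)) (G.count≤1 (G.adj? x) c leaf))

  min-degree≡1 : δ G ≡ 1 → (H : Graph) →
    IsPerfectRomanDominationNumber (G ∘ₗ H) ((2 * δ H + 4) ⊓ ((order H ∸ Δ H) + 1))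
  min-degree≡1 δ≡1 H = attained , lower
    where
    open Lexicographic G H
      using (module GH; universalCopy-attains; edgeCopies-attain; PRDF-bound)
    A B : ℕ
    A = 2 * δ H + 4
    B = (order H ∸ Δ H) + 1

    attained-A : Σ[ f ∈ _ ] GH.PRDF f × GH.weight f ≡ A
    attained-A with G.δ-attained
    -- A vertex of minimum degree is a leaf here; its only neighbour supplies the other end of the
    -- edge.
    ... | l , degree≡δ with G.count≡1⇒unique (G.adj? l) (trans degree≡δ δ≡1)
    ...   | x , lx , leaf = edgeCopies-attain lx leaf (leaf-neighbour-universal G universal lx leaf)

    attained : Σ[ f ∈ _ ] GH.PRDF f × GH.weight f ≡ A ⊓ B
    attained with ⊓-sel A B
    ... | inj₁ A⊓B≡A rewrite A⊓B≡A = attained-A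
    ... | inj₂ A⊓B≡B rewrite A⊓B≡B = universalCopy-attains c universal

    lower : ∀ f → GH.PRDF f → A ⊓ B ≤ GH.weight f
    lower f prdf with PRDF-bound nontrivial c universal f prdf
    ... | inj₁ bound           = ≤-trans (m⊓n≤n A B) bound
    ... | inj₂ (_ , _ , bound) = ≤-trans (m⊓n≤m A B) bound
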